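{- Let $a,b\ge1$, $P=[a]\times[b]$, fix an integer $k$ with $1-a\le k\le b-1$, and let $B=\{(i,j)\in P\colon j-i=k\}$. Then $\sum_{p\in B}\mathbb{1}_p\equiv c$, where $c=a(b-k)/(a+b)$ if $k\ge0$ and $c=b(a+k)/(a+b)$ if $k<0$.
   Context: $[a]\times[b]=\{(i,j)\colon 1\le i\le a,\ 1\le j\le b\}$ with $(i,j)\le(i',j')$ iff $i\le i'$ and $j\le j'$. $\mathcal{J}(P)$ is the set of order ideals of $P$. For $x\in P$, $I\in\mathcal{J}(P)$: $\mathbb{1}_x(I)=1$ if $x\in I$, else $0$; $T_x^+(I)=1$ if $x$ is a minimal element of $P\setminus I$, else $0$; $T_x^-(I)=1$ if $x$ is a maximal element of $I$, else $0$; $T_x=T_x^+-T_x^-$. For statistics $f,g\colon\mathcal{J}(P)\to\mathbb{R}$, $f\equiv g$ means there exist real constants $c_x$ ($x\in P$) with $f-g=\sum_{x\in P}c_xT_x$; a real number $c$ denotes the constant function $c$. -}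

module Defs where

open import Data.Bool using (Bool; true; if_then_else_)
import Data.Bool.Properties as Bool
open import Data.Fin as Fin using (Fin; toℕ)
import Data.Fin.Properties as Fin
open import Data.Integer as ℤ using (ℤ; +_; -[1+_])
open import Data.List using (List; foldr; filter; allFin; cartesianProduct)
open import Data.List.Membership.Propositional using (_∈_)
open import Data.List.Membership.Propositional.Properties using (∈-allFin; ∈-cartesianProduct⁺)
import Data.List.Relation.Unary.All as All
open import Data.List.Relation.Unary.Unique.Propositional using (Unique)
open import Data.List.Relation.Unary.Unique.Propositional.Properties using (allFin⁺; cartesianProduct⁺)
open import Data.Nat as ℕ using (ℕ; suc; NonZero)
import Data.Nat.Properties as ℕ
open import Data.Product using (Σ-syntax; ∃-syntax; _×_; _,_; proj₁; proj₂)
open import Data.Rational as ℚ using (ℚ; 0ℚ; 1ℚ; ½; ∣_∣; _/_)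
import Data.Rational.Properties as ℚ
open import Data.Rational.Solver using (module +-*-Solver)
open import Relation.Binary.PropositionalEquality using (_≡_; refl; sym; trans; cong; cong₂; subst; isEquivalence)
open import Relation.Binary.Structures using (IsDecPartialOrder)
open import Relation.Nullary using (Dec; does; ¬?; _×-dec_; _→-dec_; map′)
open import Relation.Unary using (Pred; Decidable; ∁)
open import Level using (0ℓ)

------------------------------------------------------------------------
-- The real numbers: Cauchy sequences of rationals, compared with the
-- setoid equality _≃_ (the difference tends to 0).

Cauchy : (ℕ → ℚ) → Set
Cauchy x = ∀ ε → 0ℚ ℚ.< ε →
  ∃[ N ] (∀ m n → N ℕ.≤ m → N ℕ.≤ n → ∣ x m ℚ.- x n ∣ ℚ.< ε)

record ℝ : Set where
  constructor mkℝ
  field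
    seq    : ℕ → ℚ
    cauchy : Cauchy seq

open ℝ public

infix  4 _≃_
infixl 6 _+ᴿ_ _-ᴿ_
infixl 7 _*ᴿ_
infix  8 -ᴿ_

_≃_ : ℝ → ℝ → Set
x ≃ y = ∀ ε → 0ℚ ℚ.< ε →
  ∃[ N ] (∀ n → N ℕ.≤ n → ∣ seq x n ℚ.- seq y n ∣ ℚ.< ε)

fromℚ : ℚ → ℝ
fromℚ q = mkℝ (λ _ → q) λ ε 0<ε → 0 , λ _ _ _ _ →
  subst (ℚ._< ε) (sym (cong ∣_∣ (ℚ.+-inverseʳ q))) 0<ε

0ᴿ 1ᴿ : ℝ
0ᴿ = fromℚ 0ℚ
1ᴿ = fromℚ 1ℚ

private
  open +-*-Solver using (solve; _:=_; _:+_; _:*_; _:-_; :-_)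
  open ℚ.≤-Reasoning

  sub-interchange : ∀ p q r s → (p ℚ.+ q) ℚ.- (r ℚ.+ s) ≡ (p ℚ.- r) ℚ.+ (q ℚ.- s)
  sub-interchange = solve 4 (λ p q r s → (p :+ q) :- (r :+ s) := (p :- r) :+ (q :- s)) refl

  neg-sub : ∀ p q → ℚ.- (p ℚ.- q) ≡ ℚ.- p ℚ.- (ℚ.- q)
  neg-sub = solve 2 (λ p q → :- (p :- q) := :- p :- (:- q)) refl

  add-sub : ∀ p q → p ≡ q ℚ.+ (p ℚ.- q)
  add-sub = solve 2 (λ p q → p := q :+ (p :- q)) refl

  mul-sub : ∀ p q r s → p ℚ.* q ℚ.- r ℚ.* s ≡ p ℚ.* (q ℚ.- s) ℚ.+ s ℚ.* (p ℚ.- r)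
  mul-sub = solve 4 (λ p q r s → p :* q :- r :* s := p :* (q :- s) :+ s :* (p :- r)) refl

  half-pos : ∀ {ε} → 0ℚ ℚ.< ε → 0ℚ ℚ.< ½ ℚ.* ε
  half-pos {ε} 0<ε =
    subst (ℚ._< ½ ℚ.* ε) (ℚ.*-zeroʳ ½) (ℚ.*-monoʳ-<-pos ½ 0<ε)

  halves : ∀ ε → ½ ℚ.* ε ℚ.+ ½ ℚ.* ε ≡ ε
  halves ε = trans (sym (ℚ.*-distribʳ-+ ε ½ ½)) (ℚ.*-identityˡ ε)

  +-cauchy : ∀ x y → Cauchy (λ n → seq x n ℚ.+ seq y n)
  +-cauchy x y ε 0<ε
    with cauchy x (½ ℚ.* ε) (half-pos 0<ε) | cauchy y (½ ℚ.* ε) (half-pos 0<ε)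
  ... | K , hx | L , hy = K ℕ.⊔ L , λ m n m≥ n≥ →
    let xm = seq x m ; xn = seq x n ; ym = seq y m ; yn = seq y n in
    begin-strict
      ∣ (xm ℚ.+ ym) ℚ.- (xn ℚ.+ yn) ∣
        ≡⟨ cong ∣_∣ (sub-interchange xm ym xn yn) ⟩
      ∣ (xm ℚ.- xn) ℚ.+ (ym ℚ.- yn) ∣
        ≤⟨ ℚ.∣p+q∣≤∣p∣+∣q∣ (xm ℚ.- xn) (ym ℚ.- yn) ⟩
      ∣ xm ℚ.- xn ∣ ℚ.+ ∣ ym ℚ.- yn ∣
        <⟨ ℚ.+-mono-< (hx m n (ℕ.m⊔n≤o⇒m≤o K L m≥) (ℕ.m⊔n≤o⇒m≤o K L n≥))
                      (hy m n (ℕ.m⊔n≤o⇒n≤o K L m≥) (ℕ.m⊔n≤o⇒n≤o K L n≥)) ⟩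
      ½ ℚ.* ε ℚ.+ ½ ℚ.* ε
        ≡⟨ halves ε ⟩
      ε ∎

  neg-cauchy : ∀ x → Cauchy (λ n → ℚ.- seq x n)
  neg-cauchy x ε 0<ε with cauchy x ε 0<ε
  ... | N , h = N , λ m n m≥ n≥ →
    subst (ℚ._< ε)
      (trans (sym (ℚ.∣-p∣≡∣p∣ (seq x m ℚ.- seq x n)))
             (cong ∣_∣ (neg-sub (seq x m) (seq x n))))
      (h m n m≥ n≥)

  shift-bound : ∀ {r} p q → ∣ p ℚ.- q ∣ ℚ.< r → ∣ p ∣ ℚ.< ∣ q ∣ ℚ.+ r
  shift-bound {r} p q h = begin-strict
    ∣ p ∣                     ≡⟨ cong ∣_∣ (add-sub p q) ⟩
    ∣ q ℚ.+ (p ℚ.- q) ∣       ≤⟨ ℚ.∣p+q∣≤∣p∣+∣q∣ q (p ℚ.- q) ⟩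
    ∣ q ∣ ℚ.+ ∣ p ℚ.- q ∣     <⟨ ℚ.+-monoʳ-< ∣ q ∣ h ⟩
    ∣ q ∣ ℚ.+ r               ∎

  bounded : ∀ x → ∃[ M ] ∃[ N ] (0ℚ ℚ.< M × (∀ n → N ℕ.≤ n → ∣ seq x n ∣ ℚ.< M))
  bounded x with cauchy x 1ℚ (ℚ.positive⁻¹ 1ℚ)
  ... | N , h = ∣ seq x N ∣ ℚ.+ 1ℚ , N ,
    ℚ.≤-<-trans (ℚ.0≤∣p∣ (seq x N)) (bound N ℕ.≤-refl) , bound
    where
    bound : ∀ n → N ℕ.≤ n → ∣ seq x n ∣ ℚ.< ∣ seq x N ∣ ℚ.+ 1ℚ
    bound n n≥ = shift-bound (seq x n) (seq x N) (h n N n≥ ℕ.≤-refl)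

  ∣*∣-bound : ∀ {M δ} p q → 0ℚ ℚ.< M → ∣ p ∣ ℚ.< M → ∣ q ∣ ℚ.< δ → ∣ p ℚ.* q ∣ ℚ.< M ℚ.* δ
  ∣*∣-bound {M} {δ} p q 0<M p< q< = begin-strict
    ∣ p ℚ.* q ∣       ≡⟨ ℚ.∣p*q∣≡∣p∣*∣q∣ p q ⟩
    ∣ p ∣ ℚ.* ∣ q ∣   ≤⟨ ℚ.*-monoʳ-≤-nonNeg ∣ q ∣ {{ℚ.∣-∣-nonNeg q}} (ℚ.<⇒≤ p<) ⟩
    M ℚ.* ∣ q ∣       <⟨ ℚ.*-monoʳ-<-pos M {{ℚ.positive 0<M}} q< ⟩
    M ℚ.* δ           ∎

  divide : ∀ M ε → 0ℚ ℚ.< M → 0ℚ ℚ.< ε → ∃[ δ ] (0ℚ ℚ.< δ × M ℚ.* δ ≡ ε)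
  divide M ε 0<M 0<ε = M⁻¹ ℚ.* ε , 0<δ , Mδ≡ε
    where
    instance
      M⁺ : ℚ.Positive M
      M⁺ = ℚ.positive 0<M
      M≠0 : ℚ.NonZero M
      M≠0 = ℚ.pos⇒nonZero M
    M⁻¹ = ℚ.1/ M
    0<δ : 0ℚ ℚ.< M⁻¹ ℚ.* ε
    0<δ = subst (ℚ._< M⁻¹ ℚ.* ε) (ℚ.*-zeroʳ M⁻¹)
            (ℚ.*-monoʳ-<-pos M⁻¹ {{ℚ.1/pos⇒pos M}} 0<ε)
    Mδ≡ε : M ℚ.* (M⁻¹ ℚ.* ε) ≡ ε
    Mδ≡ε = trans (sym (ℚ.*-assoc M M⁻¹ ε))
             (trans (cong (ℚ._* ε) (ℚ.*-inverseʳ M)) (ℚ.*-identityˡ ε))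

  mul-sub-bound : ∀ {A B δ} p q r s → 0ℚ ℚ.< A → 0ℚ ℚ.< B →
    ∣ p ∣ ℚ.< A → ∣ s ∣ ℚ.< B → ∣ p ℚ.- r ∣ ℚ.< δ → ∣ q ℚ.- s ∣ ℚ.< δ →
    ∣ p ℚ.* q ℚ.- r ℚ.* s ∣ ℚ.< (A ℚ.+ B) ℚ.* δ
  mul-sub-bound {A} {B} {δ} p q r s 0<A 0<B p< s< pr< qs< = begin-strict
    ∣ p ℚ.* q ℚ.- r ℚ.* s ∣
      ≡⟨ cong ∣_∣ (mul-sub p q r s) ⟩
    ∣ p ℚ.* (q ℚ.- s) ℚ.+ s ℚ.* (p ℚ.- r) ∣
      ≤⟨ ℚ.∣p+q∣≤∣p∣+∣q∣ (p ℚ.* (q ℚ.- s)) (s ℚ.* (p ℚ.- r)) ⟩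
    ∣ p ℚ.* (q ℚ.- s) ∣ ℚ.+ ∣ s ℚ.* (p ℚ.- r) ∣
      <⟨ ℚ.+-mono-< {∣ p ℚ.* (q ℚ.- s) ∣} {A ℚ.* δ} {∣ s ℚ.* (p ℚ.- r) ∣} {B ℚ.* δ}
           (∣*∣-bound p (q ℚ.- s) 0<A p< qs<) (∣*∣-bound s (p ℚ.- r) 0<B s< pr<) ⟩
    A ℚ.* δ ℚ.+ B ℚ.* δ
      ≡⟨ ℚ.*-distribʳ-+ δ A B ⟨
    (A ℚ.+ B) ℚ.* δ ∎

  +-pos : ∀ A B → 0ℚ ℚ.< A → 0ℚ ℚ.< B → 0ℚ ℚ.< A ℚ.+ B
  +-pos A B 0<A 0<B =
    ℚ.<-trans 0<A (subst (ℚ._< A ℚ.+ B) (ℚ.+-identityʳ A) (ℚ.+-monoʳ-< A 0<B))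

  *-cauchy : ∀ x y → Cauchy (λ n → seq x n ℚ.* seq y n)
  *-cauchy x y ε 0<ε =
    let A , K₁ , 0<A , bx = bounded x
        B , L₁ , 0<B , by = bounded y
        δ , 0<δ , Mδ≡ε    = divide (A ℚ.+ B) ε (+-pos A B 0<A 0<B) 0<ε
        K₂ , hx = cauchy x δ 0<δ
        L₂ , hy = cauchy y δ 0<δ
        N₁ = K₁ ℕ.⊔ L₁
        N₂ = K₂ ℕ.⊔ L₂
    in N₁ ℕ.⊔ N₂ , λ m n m≥ n≥ →
      let m≥₁ = ℕ.m⊔n≤o⇒m≤o N₁ N₂ m≥
          m≥₂ = ℕ.m⊔n≤o⇒n≤o N₁ N₂ m≥
          n≥₁ = ℕ.m⊔n≤o⇒m≤o N₁ N₂ n≥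
          n≥₂ = ℕ.m⊔n≤o⇒n≤o N₁ N₂ n≥
      in subst (∣ seq x m ℚ.* seq y m ℚ.- seq x n ℚ.* seq y n ∣ ℚ.<_) Mδ≡ε
           (mul-sub-bound {A} {B} {δ} (seq x m) (seq y m) (seq x n) (seq y n) 0<A 0<B
             (bx m (ℕ.m⊔n≤o⇒m≤o K₁ L₁ m≥₁))
             (by n (ℕ.m⊔n≤o⇒n≤o K₁ L₁ n≥₁))
             (hx m n (ℕ.m⊔n≤o⇒m≤o K₂ L₂ m≥₂) (ℕ.m⊔n≤o⇒m≤o K₂ L₂ n≥₂))
             (hy m n (ℕ.m⊔n≤o⇒n≤o K₂ L₂ m≥₂) (ℕ.m⊔n≤o⇒n≤o K₂ L₂ n≥₂)))

_+ᴿ_ : ℝ → ℝ → ℝ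
x +ᴿ y = mkℝ (λ n → seq x n ℚ.+ seq y n) (+-cauchy x y)

-ᴿ_ : ℝ → ℝ
-ᴿ x = mkℝ (λ n → ℚ.- seq x n) (neg-cauchy x)

_-ᴿ_ : ℝ → ℝ → ℝ
x -ᴿ y = x +ᴿ -ᴿ y

_*ᴿ_ : ℝ → ℝ → ℝ
x *ᴿ y = mkℝ (λ n → seq x n ℚ.* seq y n) (*-cauchy x y)

∑ : {A : Set} → List A → (A → ℝ) → ℝ
∑ xs f = foldr (λ x s → f x +ᴿ s) 0ᴿ xs

------------------------------------------------------------------------
-- Finite posets, order ideals and statistics

record FinPoset : Set₁ where
  field
    Carrier           : Set
    _≤_               : Carrier → Carrier → Set
    isDecPartialOrder : IsDecPartialOrder _≡_ _≤_
    elements          : List Carrier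
    complete          : ∀ x → x ∈ elements
    unique            : Unique elements

  open IsDecPartialOrder isDecPartialOrder public using (_≟_; _≤?_)

  all? : {Q : Pred Carrier 0ℓ} → Decidable Q → Dec (∀ x → Q x)
  all? Q? = map′ (λ h x → All.lookup h (complete x)) (λ h → All.tabulate (λ {x} _ → h x))
              (All.all? Q? elements)

module _ (P : FinPoset) where
  open FinPoset P

  IsMinimal IsMaximal : Pred Carrier 0ℓ → Carrier → Set
  IsMinimal S x = S x × (∀ y → S y → y ≤ x → y ≡ x)
  IsMaximal S x = S x × (∀ y → S y → x ≤ y → y ≡ x)

  -- Subsets of the finite set Carrier are given by Bool-valued
  -- characteristic functions, so that membership is decidable.
  record OrderIdeal : Set where
    field
      χ          : Carrier → Bool
      downClosed : ∀ {x y} → x ≤ y → χ y ≡ true → χ x ≡ true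

  open OrderIdeal

  Mem : OrderIdeal → Pred Carrier 0ℓ
  Mem I x = χ I x ≡ true

  mem? : (I : OrderIdeal) → Decidable (Mem I)
  mem? I x = χ I x Bool.≟ true

  minimal? : ∀ {S} → Decidable S → Decidable (IsMinimal S)
  minimal? S? x = S? x ×-dec all? (λ y → S? y →-dec (y ≤? x →-dec y ≟ x))

  maximal? : ∀ {S} → Decidable S → Decidable (IsMaximal S)
  maximal? S? x = S? x ×-dec all? (λ y → S? y →-dec (x ≤? y →-dec y ≟ x))

  Statistic : Set
  Statistic = OrderIdeal → ℝ

  indicator : ∀ {Q : Set} → Dec Q → ℝ
  indicator Q? = if does Q? then 1ᴿ else 0ᴿ

  𝟙 T⁺ T⁻ T : Carrier → Statistic
  𝟙 x I = indicator (mem? I x)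
  T⁺ x I = indicator (minimal? (λ y → ¬? (mem? I y)) x)
  T⁻ x I = indicator (maximal? (mem? I) x)
  T x I = T⁺ x I -ᴿ T⁻ x I

  const : ℝ → Statistic
  const r _ = r

module _ {P : FinPoset} where
  open FinPoset P

  infix 4 _≡ₜ_

  _≡ₜ_ : Statistic P → Statistic P → Set
  f ≡ₜ g = Σ[ c ∈ (Carrier → ℝ) ]
    (∀ I → f I -ᴿ g I ≃ ∑ elements (λ x → c x *ᴿ T P x I))

------------------------------------------------------------------------
-- The product of two chains [a] × [b]

Box : ℕ → ℕ → FinPoset
Box a b = record
  { Carrier = Fin a × Fin b
  ; _≤_ = λ p q → (proj₁ p Fin.≤ proj₁ q) × (proj₂ p Fin.≤ proj₂ q)
  ; isDecPartialOrder = record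
    { isPartialOrder = record
      { isPreorder = record
        { isEquivalence = isEquivalence
        ; reflexive = λ { refl → ℕ.≤-refl , ℕ.≤-refl }
        ; trans = λ (r , s) (r′ , s′) → ℕ.≤-trans r r′ , ℕ.≤-trans s s′
        }
      ; antisym = λ (r , s) (r′ , s′) → cong₂ _,_ (Fin.≤-antisym r r′) (Fin.≤-antisym s s′)
      }
    ; _≟_ = λ (i , j) (i′ , j′) →
        map′ (λ (r , s) → cong₂ _,_ r s) (λ r → cong proj₁ r , cong proj₂ r)
          ((i Fin.≟ i′) ×-dec (j Fin.≟ j′))
    ; _≤?_ = λ (i , j) (i′ , j′) → (i Fin.≤? i′) ×-dec (j Fin.≤? j′)
    }
  ; elements = cartesianProduct (allFin a) (allFin b)
  ; complete = λ (i , j) → ∈-cartesianProduct⁺ (∈-allFin i) (∈-allFin j)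
  ; unique = cartesianProduct⁺ (allFin⁺ a) (allFin⁺ b)
  }

-- Fin is 0-based, the coordinates of [a] × [b] are 1-based.
row col : ∀ {a b} → Fin a × Fin b → ℤ
row (i , _) = + suc (toℕ i)
col (_ , j) = + suc (toℕ j)

diagonal : (a b : ℕ) → ℤ → List (Fin a × Fin b)
diagonal a b k = filter (λ p → col p ℤ.- row p ℤ.≟ k) (FinPoset.elements (Box a b))

diagonalConstant : (a b : ℕ) .{{_ : NonZero (a ℕ.+ b)}} → ℤ → ℚ
diagonalConstant a b k@(+ _)      = (+ a ℤ.* (+ b ℤ.- k)) / (a ℕ.+ b)
diagonalConstant a b k@(-[1+ _ ]) = (+ b ℤ.* (+ a ℤ.+ k)) / (a ℕ.+ b)

instance
  +-nonZero : ∀ {a b} .{{_ : NonZero a}} → NonZero (a ℕ.+ b)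
  +-nonZero {suc _} = _

{-# OPTIONS --safe #-}
module Submission where

open import Defs
open import Data.Bool using (true; false; if_then_else_)
open import Data.Fin using (Fin; toℕ; fromℕ<) renaming (zero to fzero; suc to fsuc)
import Data.Fin.Properties as Fin
open import Data.Integer as ℤ using (-[1+_]; _⊖_; +≤+; -≤+)
open import Data.Integer using (ℤ; +_; _-_; _≤_)
import Data.Integer.Properties as ℤ
import Data.Integer.Solver as ℤ
open import Data.List
  using (List; []; _∷_; _++_; map; foldr; filter; tabulate; allFin; cartesianProduct)
open import Data.List.Properties using (foldr-map)
open import Data.Nat as ℕ using (zero; suc; s≤s)
open import Data.Nat using (ℕ; NonZero)
import Data.Nat.Properties as ℕ
open import Data.Product using (∃-syntax; _×_; _,_; proj₁; proj₂)
open import Data.Rational as ℚ using (ℚ; 0ℚ; 1ℚ)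
import Data.Rational.Properties as ℚ
open import Data.Rational.Solver using (module +-*-Solver)
open import Data.Rational.Unnormalised as ℚᵘ using (mkℚᵘ; *≡*)
import Data.Rational.Unnormalised.Properties as ℚᵘ
open import Data.Sum using (_⊎_; inj₁; inj₂)
open import Function using (mk⇔)
open import Relation.Binary.PropositionalEquality
open import Relation.Nullary using (Dec; yes; no; does; ¬_; ¬?; _×-dec_; _⊎-dec_; contradiction)
open import Relation.Nullary.Decidable using (does-⇔; dec-true; dec-false; decidable-stable)
open import Relation.Unary using (Pred; Decidable; ∁)
open import Level using (0ℓ)
open import Algebra.Properties.CommutativeMonoid.Sum ℚ.+-0-commutativeMonoid
  using (sum; sum-cong-≗; ∑-comm; ∑-distrib-+)

-- Give x = (i , j) the coefficient g (j − i), where g (d) = max (d − k , 0) − (b − k)(d + a) / (a + b)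
-- is the discrete Green function: it vanishes at d = −a and d = b, and its second difference is
-- the indicator of d = k. Extend the indicator χ of an ideal to e on ℕ², with value 1 on the
-- axes and 0 beyond the box. Then T⁺ (i , j) − T⁻ (i − 1 , j − 1) is minus the mixed second difference
-- e (i , j) − e (i − 1 , j) − e (i , j − 1) + e (i − 1 , j − 1), the products in T⁺ and T⁻ cancelling,
-- and g takes the same value at (i , j) and (i − 1 , j − 1). Summation by parts in both coordinates
-- moves the difference to g, which leaves the sum of χ over the diagonal j − i = k and the boundary
-- term g (0) = −c.

-- Finite sums of rationals and summation by parts.

-- Opaque so that unification can read the summand off a sum.
opaque

  Σ< : ℕ → (ℕ → ℚ) → ℚ
  Σ< n f = sum {n} (λ i → f (toℕ i))

  Σ<-zero : ∀ f → Σ< 0 f ≡ 0ℚ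
  Σ<-zero f = refl

  Σ<-suc : ∀ n f → Σ< (suc n) f ≡ f 0 ℚ.+ Σ< n (λ i → f (suc i))
  Σ<-suc n f = refl

  Σ<-cong : ∀ n {f g} → (∀ i → f i ≡ g i) → Σ< n f ≡ Σ< n g
  Σ<-cong n f≗g = sum-cong-≗ {n} (λ i → f≗g (toℕ i))

  Σ<-distrib-+ : ∀ n f g → Σ< n (λ i → f i ℚ.+ g i) ≡ Σ< n f ℚ.+ Σ< n g
  Σ<-distrib-+ n f g = ∑-distrib-+ {n} (λ i → f (toℕ i)) (λ i → g (toℕ i))

  Σ<-comm : ∀ m n (f : ℕ → ℕ → ℚ) →
    Σ< m (λ i → Σ< n (f i)) ≡ Σ< n (λ j → Σ< m (λ i → f i j))
  Σ<-comm m n f = ∑-comm {m} {n} (λ i j → f (toℕ i) (toℕ j))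

Σ<² : ℕ → ℕ → (ℕ → ℕ → ℚ) → ℚ
Σ<² m n f = Σ< m (λ i → Σ< n (f i))

Σ<²-cong : ∀ m n {f g} → (∀ i j → f i j ≡ g i j) → Σ<² m n f ≡ Σ<² m n g
Σ<²-cong m n f≗g = Σ<-cong m (λ i → Σ<-cong n (f≗g i))

Σ<²-distrib-+ : ∀ m n f g → Σ<² m n (λ i j → f i j ℚ.+ g i j) ≡ Σ<² m n f ℚ.+ Σ<² m n g
Σ<²-distrib-+ m n f g = trans
  (Σ<-cong m (λ i → Σ<-distrib-+ n (f i) (g i)))
  (Σ<-distrib-+ m (λ i → Σ< n (f i)) (λ i → Σ< n (g i)))

Σ<-vanish : ∀ n {f} → (∀ i → f i ≡ 0ℚ) → Σ< n f ≡ 0ℚ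
Σ<-vanish zero    {f} _  = Σ<-zero f
Σ<-vanish (suc n) {f} f0 =
  trans (Σ<-suc n f) (cong₂ ℚ._+_ (f0 0) (Σ<-vanish n (λ i → f0 (suc i))))

Σ<-tail : ∀ n {f} → f 0 ≡ 0ℚ → Σ< (suc n) f ≡ Σ< n (λ i → f (suc i))
Σ<-tail n {f} f0 = trans (Σ<-suc n f)
  (trans (cong (λ x → x ℚ.+ Σ< n (λ i → f (suc i))) f0) (ℚ.+-identityˡ (Σ< n (λ i → f (suc i)))))

Σ<-init : ∀ n {f} → f n ≡ 0ℚ → Σ< (suc n) f ≡ Σ< n f
Σ<-init zero    {f} f0 = trans (Σ<-tail 0 f0) (trans (Σ<-zero (λ i → f (suc i))) (sym (Σ<-zero f)))
Σ<-init (suc n) {f} fn = trans (Σ<-suc (suc n) f)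
  (trans (cong (f 0 ℚ.+_) (Σ<-init n fn)) (sym (Σ<-suc n f)))

Σ<²-init : ∀ m n {f} → (∀ j → f m j ≡ 0ℚ) → (∀ i → f i n ≡ 0ℚ) →
  Σ<² (suc m) (suc n) f ≡ Σ<² m n f
Σ<²-init m n fm fn =
  trans (Σ<-init m (Σ<-vanish (suc n) fm)) (Σ<-cong m (λ i → Σ<-init n (fn i)))

Σ<²-tail : ∀ m n {f} → (∀ j → f 0 j ≡ 0ℚ) → (∀ i → f i 0 ≡ 0ℚ) →
  Σ<² (suc m) (suc n) f ≡ Σ<² m n (λ i j → f (suc i) (suc j))
Σ<²-tail m n f0 f0′ =
  trans (Σ<-tail m (Σ<-vanish (suc n) f0)) (Σ<-cong m (λ i → Σ<-tail n (f0′ (suc i))))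

module _ where
  open +-*-Solver
  open ≡-Reasoning

  -- Summation by parts. In the induction the lower boundary term `g 1 ℚ.* r 1` of the tail joins
  -- the `g 0 ℚ.* r 1` of the detached summand to form the new first summand on the right.
  Σ<-abel : ∀ n (g r : ℕ → ℚ) →
    Σ< (suc n) (λ i → g i ℚ.* (r (suc i) ℚ.- r i)) ≡
    g n ℚ.* r (suc n) ℚ.- g 0 ℚ.* r 0 ℚ.+ Σ< n (λ i → (g i ℚ.- g (suc i)) ℚ.* r (suc i))
  Σ<-abel zero g r = begin
    Σ< 1 d                               ≡⟨ Σ<-suc 0 d ⟩
    d 0 ℚ.+ Σ< 0 (λ i → d (suc i))       ≡⟨ cong (d 0 ℚ.+_) (Σ<-zero (λ i → d (suc i))) ⟩
    d 0 ℚ.+ 0ℚ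
      ≡⟨ solve 3 (λ g₀ r₀ r₁ → g₀ :* (r₁ :- r₀) :+ con 0ℚ := g₀ :* r₁ :- g₀ :* r₀ :+ con 0ℚ)
           refl (g 0) (r 0) (r 1) ⟩
    g 0 ℚ.* r 1 ℚ.- g 0 ℚ.* r 0 ℚ.+ 0ℚ
      ≡⟨ cong (g 0 ℚ.* r 1 ℚ.- g 0 ℚ.* r 0 ℚ.+_) (Σ<-zero _) ⟨
    _ ∎
    where
    d : ℕ → ℚ
    d i = g i ℚ.* (r (suc i) ℚ.- r i)
  Σ<-abel (suc n) g r = begin
    Σ< (suc (suc n)) d
      ≡⟨ Σ<-suc (suc n) d ⟩
    d 0 ℚ.+ Σ< (suc n) (λ i → d (suc i))
      ≡⟨ cong (d 0 ℚ.+_) (Σ<-abel n (λ i → g (suc i)) (λ i → r (suc i))) ⟩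
    d 0 ℚ.+ (z ℚ.- g 1 ℚ.* r 1 ℚ.+ s)
      ≡⟨ solve 6 (λ g₀ g₁ r₀ r₁ z s →
             g₀ :* (r₁ :- r₀) :+ (z :- g₁ :* r₁ :+ s) := z :- g₀ :* r₀ :+ ((g₀ :- g₁) :* r₁ :+ s))
           refl (g 0) (g 1) (r 0) (r 1) z s ⟩
    z ℚ.- g 0 ℚ.* r 0 ℚ.+ (d′ 0 ℚ.+ s)
      ≡⟨ cong (z ℚ.- g 0 ℚ.* r 0 ℚ.+_) (Σ<-suc n d′) ⟨
    z ℚ.- g 0 ℚ.* r 0 ℚ.+ Σ< (suc n) d′ ∎
    where
    d d′ : ℕ → ℚ
    d i = g i ℚ.* (r (suc i) ℚ.- r i)
    d′ i = (g i ℚ.- g (suc i)) ℚ.* r (suc i)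
    z = g (suc n) ℚ.* r (suc (suc n))
    s = Σ< n (λ i → d′ (suc i))

  Σ<-telescope : ∀ n (f : ℕ → ℚ) → Σ< n (λ i → f i ℚ.- f (suc i)) ≡ f 0 ℚ.- f n
  Σ<-telescope zero    f = trans (Σ<-zero (λ i → f i ℚ.- f (suc i))) (sym (ℚ.+-inverseʳ (f 0)))
  Σ<-telescope (suc n) f = trans (Σ<-suc n (λ i → f i ℚ.- f (suc i))) (trans
    (cong (f 0 ℚ.- f 1 ℚ.+_) (Σ<-telescope n (λ i → f (suc i))))
    (solve 3 (λ x y z → x :- y :+ (y :- z) := x :- z) refl (f 0) (f 1) (f (suc n))))

-- Summation by parts on the grid.

module Lattice (a b : ℕ) (g e : ℕ → ℕ → ℚ)
  (g-shift : ∀ i j → g (suc i) (suc j) ≡ g i j) (g-top : g 0 b ≡ 0ℚ) (g-bot : g a 0 ≡ 0ℚ)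
  (e-left : ∀ j → e 0 j ≡ 1ℚ) (e-low : ∀ i → e i 0 ≡ 1ℚ)
  (e-right : ∀ j → e (suc a) (suc j) ≡ 0ℚ) (e-high : ∀ i → e (suc i) (suc b) ≡ 0ℚ)
  where

  open +-*-Solver
  open ≡-Reasoning

  -- t⁺ i j is T⁺ at the 1-based point (i + 1 , j + 1), which has coefficient g i j, whereas
  -- t⁻ i j is T⁻ at (i , j): this offset makes the products in t⁺ i j − t⁻ i j cancel.
  t⁺ t⁻ : ℕ → ℕ → ℚ
  t⁺ i j = e i (suc j) ℚ.* e (suc i) j ℚ.- e (suc i) (suc j)
  t⁻ i j = e i j ℚ.- e (suc i) j ℚ.- e i (suc j) ℚ.+ e i (suc j) ℚ.* e (suc i) j

  h : ℕ → ℕ → ℚ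
  h i j = g i j ℚ.- g i (suc j)

  r : ℕ → ℕ → ℚ
  r i j = e i j ℚ.- e (suc i) j

  -- For `j > 0` the zeros of `e` beyond the box make `t⁺ a j` vanish. At `j = 0` the axis value
  -- `e (suc a) 0 = 1` leaves `t⁺ a 0 = e a 1`, which may be 1, so the zero of `g` at difference
  -- `−a` takes over.
  gt⁺-right : ∀ j → g a j ℚ.* t⁺ a j ≡ 0ℚ
  gt⁺-right zero    = trans (cong (ℚ._* t⁺ a 0) g-bot) (ℚ.*-zeroˡ (t⁺ a 0))
  gt⁺-right (suc j) = trans
    (cong₂ (λ x y → g a (suc j) ℚ.* (e a (suc (suc j)) ℚ.* x ℚ.- y)) (e-right j) (e-right (suc j)))
    (solve 2 (λ x y → x :* (y :* con 0ℚ :- con 0ℚ) := con 0ℚ) refl (g a (suc j)) (e a (suc (suc j))))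

  -- The mirror image: at the corner `(0 , b)` the zero of `g` at difference `b` takes over.
  gt⁺-high : ∀ i → g i b ℚ.* t⁺ i b ≡ 0ℚ
  gt⁺-high zero    = trans (cong (ℚ._* t⁺ 0 b) g-top) (ℚ.*-zeroˡ (t⁺ 0 b))
  gt⁺-high (suc i) = trans
    (cong₂ (λ x y → g (suc i) b ℚ.* (x ℚ.* e (suc (suc i)) b ℚ.- y)) (e-high i) (e-high (suc i)))
    (solve 2 (λ x y → x :* (con 0ℚ :* y :- con 0ℚ) := con 0ℚ) refl (g (suc i) b) (e (suc (suc i)) b))

  -- `e` is constantly 1 on the axis, so `t⁻ 0 j` is `1 − e 1 j − 1 + e 1 j`.
  gt⁻-left : ∀ j → g 0 j ℚ.* ℚ.- t⁻ 0 j ≡ 0ℚ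
  gt⁻-left j = trans
    (cong₂ (λ x y → g 0 j ℚ.* ℚ.- (x ℚ.- e 1 j ℚ.- y ℚ.+ y ℚ.* e 1 j)) (e-left j) (e-left (suc j)))
    (solve 2 (λ x y → x :* :- (con 1ℚ :- y :- con 1ℚ :+ con 1ℚ :* y) := con 0ℚ) refl (g 0 j) (e 1 j))

  gt⁻-low : ∀ i → g i 0 ℚ.* ℚ.- t⁻ i 0 ≡ 0ℚ
  gt⁻-low i = trans
    (cong₂ (λ x y → g i 0 ℚ.* ℚ.- (x ℚ.- y ℚ.- e i 1 ℚ.+ e i 1 ℚ.* y)) (e-low i) (e-low (suc i)))
    (solve 2 (λ x y → x :* :- (con 1ℚ :- con 1ℚ :- y :+ y :* con 1ℚ) := con 0ℚ) refl (g i 0) (e i 1))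

  -- The sum of `t⁺` gains a zero row and column at the far end; the sum of `t⁻`, shifted by
  -- `(1 , 1)`, gains them at the near end. Both then run over the same grid and combine term by
  -- term.
  toggles⇒differences :
    Σ<² a b (λ i j → g i j ℚ.* (t⁺ i j ℚ.- t⁻ (suc i) (suc j))) ≡
    Σ<² (suc a) (suc b) (λ i j → g i j ℚ.* (r i (suc j) ℚ.- r i j))
  toggles⇒differences = begin
    Σ<² a b (λ i j → g i j ℚ.* (t⁺ i j ℚ.- t⁻ (suc i) (suc j)))
      -- `g-shift` gives `t⁻` a coefficient at its own index.
      ≡⟨ Σ<²-cong a b (λ i j → trans (ℚ.*-distribˡ-+ (g i j) (t⁺ i j) (ℚ.- t⁻ (suc i) (suc j)))
           (cong (λ x → g i j ℚ.* t⁺ i j ℚ.+ x ℚ.* ℚ.- t⁻ (suc i) (suc j)) (sym (g-shift i j)))) ⟩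
    Σ<² a b (λ i j → g i j ℚ.* t⁺ i j ℚ.+ g (suc i) (suc j) ℚ.* ℚ.- t⁻ (suc i) (suc j))
      ≡⟨ Σ<²-distrib-+ a b
           (λ i j → g i j ℚ.* t⁺ i j) (λ i j → g (suc i) (suc j) ℚ.* ℚ.- t⁻ (suc i) (suc j)) ⟩
    Σ<² a b (λ i j → g i j ℚ.* t⁺ i j) ℚ.+
    Σ<² a b (λ i j → g (suc i) (suc j) ℚ.* ℚ.- t⁻ (suc i) (suc j))
      ≡⟨ cong₂ ℚ._+_ (Σ<²-init a b gt⁺-right gt⁺-high) (Σ<²-tail a b gt⁻-left gt⁻-low) ⟨
    Σ<² (suc a) (suc b) (λ i j → g i j ℚ.* t⁺ i j) ℚ.+
    Σ<² (suc a) (suc b) (λ i j → g i j ℚ.* ℚ.- t⁻ i j)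
      ≡⟨ Σ<²-distrib-+ (suc a) (suc b) (λ i j → g i j ℚ.* t⁺ i j) (λ i j → g i j ℚ.* ℚ.- t⁻ i j) ⟨
    Σ<² (suc a) (suc b) (λ i j → g i j ℚ.* t⁺ i j ℚ.+ g i j ℚ.* ℚ.- t⁻ i j)
      -- The products `e i (suc j) ℚ.* e (suc i) j` cancel here; what remains is linear in `e`.
      ≡⟨ Σ<²-cong (suc a) (suc b) (λ i j →
           solve 5 (λ x p q s t →
               x :* (q :* s :- t) :+ x :* :- (p :- s :- q :+ q :* s) := x :* (q :- t :- (p :- s)))
             refl (g i j) (e i j) (e i (suc j)) (e (suc i) j) (e (suc i) (suc j))) ⟩
    Σ<² (suc a) (suc b) (λ i j → g i j ℚ.* (r i (suc j) ℚ.- r i j)) ∎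

  -- Both boundary terms vanish. At `j = 0` the two axis values in `r` cancel. At `j = b` the values
  -- beyond the box are 0, except that `r 0 (suc b) = 1`, where `g 0 b = 0` helps.
  row-sum : ∀ i →
    Σ< (suc b) (λ j → g i j ℚ.* (r i (suc j) ℚ.- r i j)) ≡ Σ< b (λ j → h i j ℚ.* r i (suc j))
  row-sum i = begin
    Σ< (suc b) (λ j → g i j ℚ.* (r i (suc j) ℚ.- r i j))
      ≡⟨ Σ<-abel b (g i) (r i) ⟩
    g i b ℚ.* r i (suc b) ℚ.- g i 0 ℚ.* r i 0 ℚ.+ s
      ≡⟨ cong₂ (λ x y → x ℚ.- g i 0 ℚ.* y ℚ.+ s) (last i) r-low ⟩
    0ℚ ℚ.- g i 0 ℚ.* 0ℚ ℚ.+ s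
      ≡⟨ solve 2 (λ x y → con 0ℚ :- x :* con 0ℚ :+ y := y) refl (g i 0) s ⟩
    s ∎
    where
    s = Σ< b (λ j → h i j ℚ.* r i (suc j))
    last : ∀ i → g i b ℚ.* r i (suc b) ≡ 0ℚ
    last zero    = trans (cong (ℚ._* r 0 (suc b)) g-top) (ℚ.*-zeroˡ (r 0 (suc b)))
    last (suc i) = trans
      (cong (g (suc i) b ℚ.*_) (cong₂ ℚ._-_ (e-high i) (e-high (suc i)))) (ℚ.*-zeroʳ (g (suc i) b))
    r-low : r i 0 ≡ 0ℚ
    r-low = cong₂ ℚ._-_ (e-low i) (e-low (suc i))

  -- Here one boundary term survives: `e` is 0 at `(a + 1 , j + 1)` but 1 on the axis, which leaves
  -- `h 0 j`.
  column-sum : ∀ j →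
    Σ< (suc a) (λ i → h i j ℚ.* r i (suc j)) ≡
    h 0 j ℚ.+ Σ< a (λ i → (h (suc i) j ℚ.- h i j) ℚ.* e (suc i) (suc j))
  column-sum j = begin
    Σ< (suc a) (λ i → h i j ℚ.* r i (suc j))
      -- `r` subtracts the later value of `e` from the earlier one; moving the sign to `h` gives the
      -- shape of `Σ<-abel`.
      ≡⟨ Σ<-cong (suc a) (λ i →
           solve 3 (λ x y z → x :* (y :- z) := :- x :* (z :- y)) refl
             (h i j) (e i (suc j)) (e (suc i) (suc j))) ⟩
    Σ< (suc a) (λ i → ℚ.- h i j ℚ.* (e (suc i) (suc j) ℚ.- e i (suc j)))
      ≡⟨ Σ<-abel a (λ i → ℚ.- h i j) (λ i → e i (suc j)) ⟩
    ℚ.- h a j ℚ.* e (suc a) (suc j) ℚ.- ℚ.- h 0 j ℚ.* e 0 (suc j) ℚ.+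
    Σ< a (λ i → (ℚ.- h i j ℚ.- ℚ.- h (suc i) j) ℚ.* e (suc i) (suc j))
      ≡⟨ cong₂ ℚ._+_
           (trans (cong₂ (λ x y → ℚ.- h a j ℚ.* x ℚ.- ℚ.- h 0 j ℚ.* y) (e-right j) (e-left (suc j)))
             (solve 2 (λ x y → :- x :* con 0ℚ :- :- y :* con 1ℚ := y) refl (h a j) (h 0 j)))
           (Σ<-cong a (λ i →
             solve 3 (λ x y z → (:- x :- :- y) :* z := (y :- x) :* z) refl
               (h i j) (h (suc i) j) (e (suc i) (suc j)))) ⟩
    _ ∎

  -- The boundary terms `h 0 j` telescope to `g 0 0 − g 0 b`, and `g 0 b = 0`.
  toggle-sum :
    Σ<² a b (λ i j → g i j ℚ.* (t⁺ i j ℚ.- t⁻ (suc i) (suc j))) ≡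
    g 0 0 ℚ.+ Σ<² a b (λ i j → (h (suc i) j ℚ.- h i j) ℚ.* e (suc i) (suc j))
  toggle-sum = begin
    _ ≡⟨ toggles⇒differences ⟩
    _ ≡⟨ Σ<-cong (suc a) row-sum ⟩
    Σ<² (suc a) b (λ i j → h i j ℚ.* r i (suc j))
      ≡⟨ Σ<-comm (suc a) b (λ i j → h i j ℚ.* r i (suc j)) ⟩
    Σ< b (λ j → Σ< (suc a) (λ i → h i j ℚ.* r i (suc j)))
      ≡⟨ Σ<-cong b column-sum ⟩
    Σ< b (λ j → h 0 j ℚ.+ Σ< a (λ i → (h (suc i) j ℚ.- h i j) ℚ.* e (suc i) (suc j)))
      ≡⟨ Σ<-distrib-+ b (h 0) (λ j → Σ< a (λ i → (h (suc i) j ℚ.- h i j) ℚ.* e (suc i) (suc j))) ⟩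
    Σ< b (h 0) ℚ.+ Σ< b (λ j → Σ< a (λ i → (h (suc i) j ℚ.- h i j) ℚ.* e (suc i) (suc j)))
      ≡⟨ cong₂ ℚ._+_
           (trans (Σ<-telescope b (g 0))
             (trans (cong (ℚ._-_ (g 0 0)) g-top) (ℚ.+-identityʳ (g 0 0))))
           (Σ<-comm b a (λ j i → (h (suc i) j ℚ.- h i j) ℚ.* e (suc i) (suc j))) ⟩
    _ ∎

-- Indicators of decidable propositions.

⟦_⟧ : ∀ {P : Set} → Dec P → ℚ
⟦ P? ⟧ = if does P? then 1ℚ else 0ℚ

⟦⟧-true : ∀ {P : Set} (P? : Dec P) → P → ⟦ P? ⟧ ≡ 1ℚ
⟦⟧-true P? p = cong (if_then 1ℚ else 0ℚ) (dec-true P? p)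

⟦⟧-false : ∀ {P : Set} (P? : Dec P) → ¬ P → ⟦ P? ⟧ ≡ 0ℚ
⟦⟧-false P? ¬p = cong (if_then 1ℚ else 0ℚ) (dec-false P? ¬p)

⟦⟧-cong : ∀ {P Q : Set} (P? : Dec P) (Q? : Dec Q) → (P → Q) → (Q → P) → ⟦ P? ⟧ ≡ ⟦ Q? ⟧
⟦⟧-cong P? Q? f g = cong (if_then 1ℚ else 0ℚ) (does-⇔ (mk⇔ f g) P? Q?)

seq-if : ∀ β {x y n} → seq (if β then x else y) n ≡ (if β then seq x n else seq y n)
seq-if true  = refl
seq-if false = refl

-- As `R` implies `P` and `Q`, the indicators satisfy `PQR = R`, so `PQ(1 − R) = PQ − R`.
⟦⟧-minimal : ∀ {P Q R : Set} (P? : Dec P) (Q? : Dec Q) (R? : Dec R) → (R → P) → (R → Q) →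
  ⟦ P? ×-dec Q? ×-dec ¬? R? ⟧ ≡ ⟦ P? ⟧ ℚ.* ⟦ Q? ⟧ ℚ.- ⟦ R? ⟧
⟦⟧-minimal (no ¬p) _       (yes r) f _ = contradiction (f r) ¬p
⟦⟧-minimal (yes _) (no ¬q) (yes r) _ g = contradiction (g r) ¬q
⟦⟧-minimal (yes _) (yes _) (yes _) _ _ = refl
⟦⟧-minimal (yes _) (yes _) (no _)  _ _ = refl
⟦⟧-minimal (yes _) (no _)  (no _)  _ _ = refl
⟦⟧-minimal (no _)  (yes _) (no _)  _ _ = refl
⟦⟧-minimal (no _)  (no _)  (no _)  _ _ = refl

-- Inclusion-exclusion: `P` and `Q` each imply `R`, so `R(1 − P)(1 − Q)` expands with `RP = P` and
-- `RQ = Q`.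
⟦⟧-maximal : ∀ {P Q R : Set} (P? : Dec P) (Q? : Dec Q) (R? : Dec R) → (P → R) → (Q → R) →
  ⟦ R? ×-dec ¬? P? ×-dec ¬? Q? ⟧ ≡ ⟦ R? ⟧ ℚ.- ⟦ P? ⟧ ℚ.- ⟦ Q? ⟧ ℚ.+ ⟦ Q? ⟧ ℚ.* ⟦ P? ⟧
⟦⟧-maximal (yes p) _       (no ¬r) f _ = contradiction (f p) ¬r
⟦⟧-maximal (no _)  (yes q) (no ¬r) _ g = contradiction (g q) ¬r
⟦⟧-maximal (no _)  (no _)  (no _)  _ _ = refl
⟦⟧-maximal (yes _) (yes _) (yes _) _ _ = refl
⟦⟧-maximal (yes _) (no _)  (yes _) _ _ = refl
⟦⟧-maximal (no _)  (yes _) (yes _) _ _ = refl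
⟦⟧-maximal (no _)  (no _)  (yes _) _ _ = refl

-- Order ideals of the box and the corners of their boundary.

module Ideal {a b : ℕ} (I : OrderIdeal (Box a b)) where
  open OrderIdeal I

  In : Fin a × Fin b → Set
  In = Mem (Box a b) I

  -- Membership of the 1-based point (i , j) in the down-closure of I and the two axes.
  Below : ℕ → ℕ → Set
  Below i j = i ≡ 0 ⊎ j ≡ 0 ⊎
    ∃[ p ] ∃[ q ] (In (p , q) × i ℕ.≤ suc (toℕ p) × j ℕ.≤ suc (toℕ q))

  below? : ∀ i j → Dec (Below i j)
  below? i j = (i ℕ.≟ 0) ⊎-dec (j ℕ.≟ 0) ⊎-dec
    Fin.any? (λ p → Fin.any? (λ q →
      mem? (Box a b) I (p , q) ×-dec (i ℕ.≤? suc (toℕ p)) ×-dec (j ℕ.≤? suc (toℕ q))))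

  Below-antitone : ∀ {i i′ j j′} → i ℕ.≤ i′ → j ℕ.≤ j′ → Below i′ j′ → Below i j
  Below-antitone i≤ _ (inj₁ refl) = inj₁ (ℕ.n≤0⇒n≡0 i≤)
  Below-antitone _ j≤ (inj₂ (inj₁ refl)) = inj₂ (inj₁ (ℕ.n≤0⇒n≡0 j≤))
  Below-antitone i≤ j≤ (inj₂ (inj₂ (p , q , pq∈I , i′≤ , j′≤))) =
    inj₂ (inj₂ (p , q , pq∈I , ℕ.≤-trans i≤ i′≤ , ℕ.≤-trans j≤ j′≤))

  ∈⇒Below : ∀ {p q} → In (p , q) → Below (suc (toℕ p)) (suc (toℕ q))
  ∈⇒Below pq∈I = inj₂ (inj₂ (_ , _ , pq∈I , ℕ.≤-refl , ℕ.≤-refl))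

  Below⇒∈ : ∀ {p q} → Below (suc (toℕ p)) (suc (toℕ q)) → In (p , q)
  Below⇒∈ (inj₂ (inj₂ (_ , _ , pq∈I , s≤s p≤ , s≤s q≤))) = downClosed (p≤ , q≤) pq∈I

  ¬Below-right : ∀ j → ¬ Below (suc a) (suc j)
  ¬Below-right j (inj₂ (inj₂ (p , _ , _ , s≤s a≤p , _))) = ℕ.<⇒≱ (Fin.toℕ<n p) a≤p

  ¬Below-high : ∀ i → ¬ Below (suc i) (suc b)
  ¬Below-high i (inj₂ (inj₂ (_ , q , _ , _ , s≤s b≤q))) = ℕ.<⇒≱ (Fin.toℕ<n q) b≤q

  module _ (p : Fin a) (q : Fin b) where
    private
      i = toℕ p
      j = toℕ q

    -- The 1-based point is `(suc i , suc j)`. Testing only two neighbours makes both conditions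
    -- polynomial in `e`; the values on the axes and beyond the box stand in for neighbours that do
    -- not exist.
    Corner⁺ Corner⁻ : Set
    Corner⁺ = Below i (suc j) × Below (suc i) j × ¬ Below (suc i) (suc j)
    Corner⁻ = Below (suc i) (suc j) × ¬ Below (suc (suc i)) (suc j) × ¬ Below (suc i) (suc (suc j))

    minimal⇒corner : IsMinimal (Box a b) (∁ In) (p , q) → Corner⁺
    minimal⇒corner (pq∉I , min) = left i refl , low j refl , λ below → pq∉I (Below⇒∈ below)
      where
      -- The equation allows a split on `toℕ p`: at 0 the neighbour is on the axis, otherwise it is
      -- a point of the box.
      left : ∀ i′ → i ≡ i′ → Below i′ (suc j)
      left zero     _    = inj₁ refl
      left (suc i′) i≡ = subst (λ x → Below (suc x) (suc j)) p′≡i′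
        -- If the neighbour were outside `I`, minimality would identify it with `(p , q)`, though
        -- its first coordinate is smaller.
        (∈⇒Below (decidable-stable (mem? (Box a b) I (p′ , q)) λ p′q∉I →
          ℕ.<⇒≢ p′<p (cong (λ x → toℕ (proj₁ x)) (min (p′ , q) p′q∉I (ℕ.<⇒≤ p′<p , ℕ.≤-refl)))))
        where
        i′<a : i′ ℕ.< a
        i′<a = ℕ.<-trans (ℕ.≤-reflexive (sym i≡)) (Fin.toℕ<n p)
        p′ = fromℕ< i′<a
        p′≡i′ : toℕ p′ ≡ i′
        p′≡i′ = Fin.toℕ-fromℕ< i′<a
        p′<p : toℕ p′ ℕ.< toℕ p
        p′<p = ℕ.≤-reflexive (trans (cong suc p′≡i′) (sym i≡))
      low : ∀ j′ → j ≡ j′ → Below (suc i) j′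
      low zero     _    = inj₂ (inj₁ refl)
      low (suc j′) j≡ = subst (λ x → Below (suc i) (suc x)) q′≡j′
        (∈⇒Below (decidable-stable (mem? (Box a b) I (p , q′)) λ pq′∉I →
          ℕ.<⇒≢ q′<q (cong (λ x → toℕ (proj₂ x)) (min (p , q′) pq′∉I (ℕ.≤-refl , ℕ.<⇒≤ q′<q)))))
        where
        j′<b : j′ ℕ.< b
        j′<b = ℕ.<-trans (ℕ.≤-reflexive (sym j≡)) (Fin.toℕ<n q)
        q′ = fromℕ< j′<b
        q′≡j′ : toℕ q′ ≡ j′
        q′≡j′ = Fin.toℕ-fromℕ< j′<b
        q′<q : toℕ q′ ℕ.< toℕ q
        q′<q = ℕ.≤-reflexive (trans (cong suc q′≡j′) (sym j≡))

    -- A point under `(p , q)` that is smaller in some coordinate lies under the left or the lower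
    -- neighbour, hence in `I`.
    corner⇒minimal : Corner⁺ → IsMinimal (Box a b) (∁ In) (p , q)
    corner⇒minimal (left , low , out) = (λ pq∈I → out (∈⇒Below pq∈I)) , min
      where
      min : ∀ y → ∁ In y → FinPoset._≤_ (Box a b) y (p , q) → y ≡ (p , q)
      min (p′ , q′) y∉I (p′≤p , q′≤q) with ℕ.m≤n⇒m<n∨m≡n p′≤p | ℕ.m≤n⇒m<n∨m≡n q′≤q
      ... | inj₁ p′<p | _ = contradiction (Below⇒∈ (Below-antitone p′<p (s≤s q′≤q) left)) y∉I
      ... | inj₂ _ | inj₁ q′<q = contradiction (Below⇒∈ (Below-antitone (s≤s p′≤p) q′<q low)) y∉I
      ... | inj₂ p′≡p | inj₂ q′≡q = cong₂ _,_ (Fin.toℕ-injective p′≡p) (Fin.toℕ-injective q′≡q)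

    -- A witness for `Below` at the right or the upper neighbour is a member of `I` strictly above
    -- `(p , q)`.
    maximal⇒corner : IsMaximal (Box a b) In (p , q) → Corner⁻
    maximal⇒corner (pq∈I , max) = ∈⇒Below pq∈I ,
      (λ { (inj₂ (inj₂ (p′ , q′ , y∈I , s≤s p<p′ , s≤s q≤q′))) →
        ℕ.<⇒≢ p<p′ (cong (λ x → toℕ (proj₁ x)) (sym (max (p′ , q′) y∈I (ℕ.<⇒≤ p<p′ , q≤q′)))) }) ,
      (λ { (inj₂ (inj₂ (p′ , q′ , y∈I , s≤s p≤p′ , s≤s q<q′))) →
        ℕ.<⇒≢ q<q′ (cong (λ x → toℕ (proj₂ x)) (sym (max (p′ , q′) y∈I (p≤p′ , ℕ.<⇒≤ q<q′)))) })

    corner⇒maximal : Corner⁻ → IsMaximal (Box a b) In (p , q)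
    corner⇒maximal (here , ¬right , ¬high) = Below⇒∈ here , max
      where
      max : ∀ y → In y → FinPoset._≤_ (Box a b) (p , q) y → y ≡ (p , q)
      max (p′ , q′) y∈I (p≤p′ , q≤q′) with ℕ.m≤n⇒m<n∨m≡n p≤p′ | ℕ.m≤n⇒m<n∨m≡n q≤q′
      ... | inj₁ p<p′ | _ = contradiction (Below-antitone (s≤s p<p′) (s≤s q≤q′) (∈⇒Below y∈I)) ¬right
      ... | inj₂ _ | inj₁ q<q′ = contradiction (Below-antitone (s≤s p≤p′) (s≤s q<q′) (∈⇒Below y∈I)) ¬high
      ... | inj₂ p≡p′ | inj₂ q≡q′ = sym (cong₂ _,_ (Fin.toℕ-injective p≡p′) (Fin.toℕ-injective q≡q′))

  e : ℕ → ℕ → ℚ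
  e i j = ⟦ below? i j ⟧

  e-left : ∀ j → e 0 j ≡ 1ℚ
  e-left j = ⟦⟧-true (below? 0 j) (inj₁ refl)

  e-low : ∀ i → e i 0 ≡ 1ℚ
  e-low i = ⟦⟧-true (below? i 0) (inj₂ (inj₁ refl))

  e-right : ∀ j → e (suc a) (suc j) ≡ 0ℚ
  e-right j = ⟦⟧-false (below? (suc a) (suc j)) (¬Below-right j)

  e-high : ∀ i → e (suc i) (suc b) ≡ 0ℚ
  e-high i = ⟦⟧-false (below? (suc i) (suc b)) (¬Below-high i)

  seq-𝟙 : ∀ p q n → seq (𝟙 (Box a b) (p , q) I) n ≡ e (suc (toℕ p)) (suc (toℕ q))
  seq-𝟙 p q n = trans (seq-if (does (mem? (Box a b) I (p , q))))
    (⟦⟧-cong (mem? (Box a b) I (p , q)) (below? (suc (toℕ p)) (suc (toℕ q))) ∈⇒Below Below⇒∈)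

  seq-T⁺ : ∀ p q n → let i = toℕ p ; j = toℕ q in
    seq (T⁺ (Box a b) (p , q) I) n ≡ e i (suc j) ℚ.* e (suc i) j ℚ.- e (suc i) (suc j)
  seq-T⁺ p q n = trans (seq-if (does T?)) (trans
    (⟦⟧-cong T? (left? ×-dec low? ×-dec ¬? here?) (minimal⇒corner p q) (corner⇒minimal p q))
    (⟦⟧-minimal left? low? here?
      (Below-antitone (ℕ.n≤1+n _) ℕ.≤-refl) (Below-antitone ℕ.≤-refl (ℕ.n≤1+n _))))
    where
    T? = minimal? (Box a b) (λ y → ¬? (mem? (Box a b) I y)) (p , q)
    left? = below? (toℕ p) (suc (toℕ q))
    low? = below? (suc (toℕ p)) (toℕ q)
    here? = below? (suc (toℕ p)) (suc (toℕ q))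

  seq-T⁻ : ∀ p q n → let i = suc (toℕ p) ; j = suc (toℕ q) in
    seq (T⁻ (Box a b) (p , q) I) n ≡
    e i j ℚ.- e (suc i) j ℚ.- e i (suc j) ℚ.+ e i (suc j) ℚ.* e (suc i) j
  seq-T⁻ p q n = trans (seq-if (does T?)) (trans
    (⟦⟧-cong T? (here? ×-dec ¬? right? ×-dec ¬? high?) (maximal⇒corner p q) (corner⇒maximal p q))
    (⟦⟧-maximal right? high? here?
      (Below-antitone (ℕ.n≤1+n _) ℕ.≤-refl) (Below-antitone ℕ.≤-refl (ℕ.n≤1+n _))))
    where
    T? = maximal? (Box a b) (mem? (Box a b) I) (p , q)
    right? = below? (suc (suc (toℕ p))) (suc (toℕ q))
    high? = below? (suc (toℕ p)) (suc (suc (toℕ q)))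
    here? = below? (suc (toℕ p)) (suc (toℕ q))

-- The discrete Green function.

_⁺ : ℤ → ℤ
(+ n)    ⁺ = + n
-[1+ _ ] ⁺ = + 0

0≤i⇒i⁺≡i : ∀ {i} → + 0 ≤ i → i ⁺ ≡ i
0≤i⇒i⁺≡i (+≤+ _) = refl

i≤0⇒i⁺≡0 : ∀ {i} → i ≤ + 0 → i ⁺ ≡ + 0
i≤0⇒i⁺≡0 (+≤+ ℕ.z≤n) = refl
i≤0⇒i⁺≡0 -≤+         = refl

-- The positive part is linear on each side of 0, with slopes 0 and 1, so its second difference is
-- concentrated at the kink.
⁺-secondDifference : ∀ i →
  (i ℤ.+ + 1) ⁺ ℤ.+ (i - + 1) ⁺ ≡ i ⁺ ℤ.+ i ⁺ ℤ.+ (if does (i ℤ.≟ + 0) then + 1 else + 0)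
⁺-secondDifference (+ zero)       = refl
⁺-secondDifference (+ suc n)      = cong +_ (begin
  suc (n ℕ.+ 1 ℕ.+ n)       ≡⟨ cong (λ x → suc (x ℕ.+ n)) (ℕ.+-comm n 1) ⟩
  suc (suc n ℕ.+ n)         ≡⟨ cong suc (ℕ.+-suc n n) ⟨
  suc n ℕ.+ suc n           ≡⟨ ℕ.+-identityʳ _ ⟨
  suc n ℕ.+ suc n ℕ.+ 0     ∎)
  where open ≡-Reasoning
⁺-secondDifference -[1+ zero ]    = refl
⁺-secondDifference -[1+ suc n ]   = refl

-- `ℚ._/_` cancels common factors, so the proof passes to unnormalised fractions, where cross
-- multiplication decides.
/-+ : ∀ i j n .{{_ : NonZero n}} → (i ℤ.+ j) ℚ./ n ≡ i ℚ./ n ℚ.+ j ℚ./ n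
/-+ i j n@(suc m) = ℚ.toℚᵘ-injective (begin
  ℚ.toℚᵘ ((i ℤ.+ j) ℚ./ n)                     ≈⟨ ℚ.toℚᵘ-fromℚᵘ (mkℚᵘ (i ℤ.+ j) m) ⟩
  mkℚᵘ (i ℤ.+ j) m                             ≈⟨ *≡* (cross i j) ⟩
  mkℚᵘ i m ℚᵘ.+ mkℚᵘ j m                       ≈⟨ ℚᵘ.+-cong (ℚ.toℚᵘ-fromℚᵘ (mkℚᵘ i m)) (ℚ.toℚᵘ-fromℚᵘ (mkℚᵘ j m)) ⟨
  ℚ.toℚᵘ (i ℚ./ n) ℚᵘ.+ ℚ.toℚᵘ (j ℚ./ n)       ≈⟨ ℚ.toℚᵘ-homo-+ (i ℚ./ n) (j ℚ./ n) ⟨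
  ℚ.toℚᵘ (i ℚ./ n ℚ.+ j ℚ./ n)                 ∎)
  where
  open ℚᵘ.≃-Reasoning
  open ℤ.+-*-Solver
  cross : ∀ i j → (i ℤ.+ j) ℤ.* (+ n ℤ.* + n) ≡ (i ℤ.* + n ℤ.+ j ℤ.* + n) ℤ.* + n
  cross i j = solve 3 (λ x y z → (x :+ y) :* (z :* z) := (x :* z :+ y :* z) :* z) refl i j (+ n)

n/n≡1 : ∀ n .{{_ : NonZero n}} → + n ℚ./ n ≡ 1ℚ
n/n≡1 n@(suc m) = ℚ.toℚᵘ-injective
  (ℚᵘ.≃-trans (ℚ.toℚᵘ-fromℚᵘ (mkℚᵘ (+ n) m)) (*≡* (ℤ.*-comm (+ n) (+ 1))))

[1+m]⊖n : ∀ m n → suc m ⊖ n ≡ m ⊖ n ℤ.+ + 1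
[1+m]⊖n m n = trans (cong (_⊖ n) (ℕ.+-comm 1 m)) (sym (ℤ.distribˡ-⊖-+-pos 1 m n))

m⊖[1+n] : ∀ m n → m ⊖ suc n ≡ m ⊖ n - + 1
m⊖[1+n] m n =
  trans (cong (λ x → m ⊖ suc x) (sym (ℕ.+-identityʳ n))) (sym (ℤ.distribˡ-⊖-+-neg 0 m n))

module Green (a b : ℕ) .{{_ : NonZero a}} (k : ℤ)
  (1-a≤k : + 1 - + a ≤ k) (k≤b-1 : k ≤ + b - + 1)
  where

  open ℤ.+-*-Solver

  -- a + b times the Green function.
  G : ℤ → ℤ
  G d = + (a ℕ.+ b) ℤ.* (d - k) ⁺ - (+ b - k) ℤ.* (d ℤ.+ + a)

  -- From `1 − a ≤ k` follows `−a ≤ k`, so the positive part is 0 at `−a`, where the factor `d + a`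
  -- vanishes too.
  G-bot : G (ℤ.- + a) ≡ + 0
  G-bot = trans (cong (λ x → + (a ℕ.+ b) ℤ.* x - (+ b - k) ℤ.* (ℤ.- + a ℤ.+ + a)) (i≤0⇒i⁺≡0 -a-k≤0))
    (solve 4 (λ n a b k → n :* con (+ 0) :- (b :- k) :* (:- a :+ a) := con (+ 0)) refl
      (+ (a ℕ.+ b)) (+ a) (+ b) k)
    where
    -a-k≤0 : ℤ.- + a - k ≤ + 0
    -a-k≤0 = ℤ.i≤j⇒i-j≤0 (ℤ.≤-trans
      (subst (ℤ.- + a ≤_) (ℤ.+-comm (ℤ.- + a) (+ 1)) (ℤ.i≤i+j (ℤ.- + a) (+ 1))) 1-a≤k)

  -- From `k ≤ b − 1` the positive part is `b − k`, and the linear part cancels `(a + b)(b − k)`.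
  G-top : G (+ b) ≡ + 0
  G-top = trans (cong (λ x → + (a ℕ.+ b) ℤ.* x - (+ b - k) ℤ.* (+ b ℤ.+ + a)) (0≤i⇒i⁺≡i 0≤b-k))
    (solve 3 (λ a b k → (a :+ b) :* (b :- k) :- (b :- k) :* (b :+ a) := con (+ 0)) refl
      (+ a) (+ b) k)
    where
    0≤b-k : + 0 ≤ + b - k
    0≤b-k = ℤ.i≤j⇒0≤j-i (ℤ.≤-trans k≤b-1 (ℤ.i-j≤i (+ b) (+ 1)))

  -- The linear part has no second difference; the kink at `d = k` is scaled by `a + b`.
  G-secondDifference : ∀ d →
    G (d ℤ.+ + 1) ℤ.+ G (d - + 1) ≡
    G d ℤ.+ G d ℤ.+ + (a ℕ.+ b) ℤ.* (if does (d - k ℤ.≟ + 0) then + 1 else + 0)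
  G-secondDifference d = begin
    G (d ℤ.+ + 1) ℤ.+ G (d - + 1)
      ≡⟨ cong₂ (λ x y → n ℤ.* x ⁺ - s ℤ.* (d ℤ.+ + 1 ℤ.+ + a) ℤ.+ (n ℤ.* y ⁺ - s ℤ.* (d - + 1 ℤ.+ + a)))
           (solve 2 (λ d k → d :+ con (+ 1) :- k := d :- k :+ con (+ 1)) refl d k)
           (solve 2 (λ d k → d :- con (+ 1) :- k := d :- k :- con (+ 1)) refl d k) ⟩
    n ℤ.* (z ℤ.+ + 1) ⁺ - s ℤ.* (d ℤ.+ + 1 ℤ.+ + a) ℤ.+ (n ℤ.* (z - + 1) ⁺ - s ℤ.* (d - + 1 ℤ.+ + a))
      ≡⟨ solve 6 (λ n x y s d a →
           n :* x :- s :* (d :+ con (+ 1) :+ a) :+ (n :* y :- s :* (d :- con (+ 1) :+ a)) :=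
           n :* (x :+ y) :- (s :* (d :+ a) :+ s :* (d :+ a)))
           refl n ((z ℤ.+ + 1) ⁺) ((z - + 1) ⁺) s d (+ a) ⟩
    n ℤ.* ((z ℤ.+ + 1) ⁺ ℤ.+ (z - + 1) ⁺) - (s ℤ.* (d ℤ.+ + a) ℤ.+ s ℤ.* (d ℤ.+ + a))
      ≡⟨ cong (λ x → n ℤ.* x - (s ℤ.* (d ℤ.+ + a) ℤ.+ s ℤ.* (d ℤ.+ + a))) (⁺-secondDifference z) ⟩
    n ℤ.* (z ⁺ ℤ.+ z ⁺ ℤ.+ δ) - (s ℤ.* (d ℤ.+ + a) ℤ.+ s ℤ.* (d ℤ.+ + a))
      ≡⟨ solve 4 (λ n x δ t →
           n :* (x :+ x :+ δ) :- (t :+ t) := n :* x :- t :+ (n :* x :- t) :+ n :* δ) refl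
           n (z ⁺) δ (s ℤ.* (d ℤ.+ + a)) ⟩
    G d ℤ.+ G d ℤ.+ n ℤ.* δ ∎
    where
    open ≡-Reasoning
    n = + (a ℕ.+ b)
    s = + b - k
    z = d - k
    δ = if does (z ℤ.≟ + 0) then + 1 else + 0

  infix 8 _/n
  _/n : ℤ → ℚ
  i /n = ℚ._/_ i (a ℕ.+ b) {{+-nonZero}}

  /n-+ : ∀ i j → (i ℤ.+ j) /n ≡ i /n ℚ.+ j /n
  /n-+ i j = /-+ i j (a ℕ.+ b) {{+-nonZero}}

  0/n : (+ 0) /n ≡ 0ℚ
  0/n = ℚ.0/n≡0 (a ℕ.+ b) {{+-nonZero}}

  /n-unit : ∀ β → (+ (a ℕ.+ b) ℤ.* (if β then + 1 else + 0)) /n ≡ (if β then 1ℚ else 0ℚ)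
  /n-unit true = trans (cong _/n (ℤ.*-identityʳ (+ (a ℕ.+ b)))) (n/n≡1 (a ℕ.+ b) {{+-nonZero}})
  /n-unit false = trans (cong _/n (ℤ.*-zeroʳ (+ (a ℕ.+ b)))) 0/n

  g : ℕ → ℕ → ℚ
  g i j = G (j ⊖ i) /n

  g-shift : ∀ i j → g (suc i) (suc j) ≡ g i j
  g-shift i j = cong (λ x → G x /n) (ℤ.[1+m]⊖[1+n]≡m⊖n j i)

  g-top : g 0 b ≡ 0ℚ
  g-top = trans (cong _/n (trans (cong G (ℤ.⊖-≥ {b} {0} ℕ.z≤n)) G-top)) 0/n

  g-bot : g a 0 ≡ 0ℚ
  g-bot = trans (cong _/n (trans (cong G (ℤ.⊖-≤ {0} {a} ℕ.z≤n)) G-bot)) 0/n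

  -- `G (+ 0)` is `(a + b)(−k)⁺ − a(b − k)`. For `k ≥ 0` the positive part is 0; for `k < 0` it is
  -- `−k`, and the whole becomes `−b(a + k)`.
  g-corner : g 0 0 ≡ ℚ.- diagonalConstant a b {{+-nonZero}} k
  g-corner = trans (inverse (G (+ 0)) (numerator k) (G₀ k)) (cong ℚ.-_ (numerator/n k))
    where
    numerator : ℤ → ℤ
    numerator k@(+ _)      = + a ℤ.* (+ b - k)
    numerator k@(-[1+ _ ]) = + b ℤ.* (+ a ℤ.+ k)
    numerator/n : ∀ k → numerator k /n ≡ diagonalConstant a b {{+-nonZero}} k
    numerator/n (+ _)    = refl
    numerator/n -[1+ _ ] = refl
    G₀ : ∀ k → + (a ℕ.+ b) ℤ.* (+ 0 - k) ⁺ - (+ b - k) ℤ.* (+ 0 ℤ.+ + a) ℤ.+ numerator k ≡ + 0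
    G₀ k@(+ m) = trans
      (cong (λ x → + (a ℕ.+ b) ℤ.* x - (+ b - k) ℤ.* (+ 0 ℤ.+ + a) ℤ.+ numerator k)
        (i≤0⇒i⁺≡0 (ℤ.i≤j⇒i-j≤0 {+ 0} {k} (+≤+ ℕ.z≤n))))
      (solve 4 (λ n a b k → n :* con (+ 0) :- (b :- k) :* (con (+ 0) :+ a) :+ a :* (b :- k) := con (+ 0))
        refl (+ (a ℕ.+ b)) (+ a) (+ b) k)
    G₀ k@(-[1+ m ]) = trans
      (cong (λ x → + (a ℕ.+ b) ℤ.* x - (+ b - k) ℤ.* (+ 0 ℤ.+ + a) ℤ.+ numerator k)
        (0≤i⇒i⁺≡i {+ 0 - k} (+≤+ ℕ.z≤n)))
      (solve 3 (λ a b k →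
          (a :+ b) :* (con (+ 0) :- k) :- (b :- k) :* (con (+ 0) :+ a) :+ b :* (a :+ k) := con (+ 0))
        refl (+ a) (+ b) k)
    inverse : ∀ i j → i ℤ.+ j ≡ + 0 → i /n ≡ ℚ.- (j /n)
    inverse i j i+j≡0 = begin
      i /n                            ≡⟨ ℚS.solve 2 (λ x y → x ℚS.:= x ℚS.:+ y ℚS.:- y) refl (i /n) (j /n) ⟩
      i /n ℚ.+ j /n ℚ.- j /n          ≡⟨ cong (ℚ._- j /n) (trans (sym (/n-+ i j)) (trans (cong _/n i+j≡0) 0/n)) ⟩
      0ℚ ℚ.- j /n                     ≡⟨ ℚ.+-identityˡ _ ⟩
      ℚ.- (j /n)                      ∎
      where
      open ≡-Reasoning
      module ℚS = +-*-Solver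

  -- `g` depends only on `d = j − i`: two of the four values sit at `d`, the others at `d − 1` and
  -- `d + 1`, so this is the second difference of `G`, divided by `a + b`.
  g-mixedDifference : ∀ i j →
    g (suc i) j ℚ.- g (suc i) (suc j) ℚ.- (g i j ℚ.- g i (suc j)) ≡
    (if does (j ⊖ i - k ℤ.≟ + 0) then 1ℚ else 0ℚ)
  g-mixedDifference i j = begin
    g (suc i) j ℚ.- g (suc i) (suc j) ℚ.- (g i j ℚ.- g i (suc j))
      ≡⟨ cong₂ (λ x y → g (suc i) j ℚ.- x ℚ.- (g i j ℚ.- y))
           (g-shift i j) (cong (λ x → G x /n) ([1+m]⊖n j i)) ⟩
    g (suc i) j ℚ.- g i j ℚ.- (g i j ℚ.- y)
      ≡⟨ cong (λ x → x ℚ.- g i j ℚ.- (g i j ℚ.- y)) (cong (λ x → G x /n) (m⊖[1+n] j i)) ⟩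
    x ℚ.- g i j ℚ.- (g i j ℚ.- y)
      ≡⟨ ℚS.solve 3 (λ x y z → x ℚS.:- z ℚS.:- (z ℚS.:- y) ℚS.:= y ℚS.:+ x ℚS.:- (z ℚS.:+ z))
           refl x y (g i j) ⟩
    y ℚ.+ x ℚ.- (g i j ℚ.+ g i j)
      ≡⟨ cong (ℚ._- (g i j ℚ.+ g i j)) y+x ⟩
    g i j ℚ.+ g i j ℚ.+ δ ℚ.- (g i j ℚ.+ g i j)
      ≡⟨ ℚS.solve 2 (λ z δ → z ℚS.:+ δ ℚS.:- z ℚS.:= δ) refl (g i j ℚ.+ g i j) δ ⟩
    δ ∎
    where
    open ≡-Reasoning
    module ℚS = +-*-Solver
    d = j ⊖ i
    x = G (d - + 1) /n
    y = G (d ℤ.+ + 1) /n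
    δ = if does (d - k ℤ.≟ + 0) then 1ℚ else 0ℚ
    y+x : y ℚ.+ x ≡ g i j ℚ.+ g i j ℚ.+ δ
    y+x = begin
      y ℚ.+ x                                      ≡⟨ /n-+ (G (d ℤ.+ + 1)) (G (d - + 1)) ⟨
      (G (d ℤ.+ + 1) ℤ.+ G (d - + 1)) /n           ≡⟨ cong _/n (G-secondDifference d) ⟩
      (G d ℤ.+ G d ℤ.+ _) /n                       ≡⟨ /n-+ (G d ℤ.+ G d) _ ⟩
      (G d ℤ.+ G d) /n ℚ.+ _
        ≡⟨ cong₂ ℚ._+_ (/n-+ (G d) (G d)) (/n-unit (does (d - k ℤ.≟ + 0))) ⟩
      g i j ℚ.+ g i j ℚ.+ δ                        ∎

-- From real sums over lists to rational sums over ℕ.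

pointwise⇒≃ : ∀ x y → (∀ n → seq x n ≡ seq y n) → x ≃ y
pointwise⇒≃ x y x≗y ε 0<ε = 0 , λ n _ → subst (ℚ._< ε)
  (sym (cong ℚ.∣_∣ (trans (cong (ℚ._- seq y n) (x≗y n)) (ℚ.+-inverseʳ (seq y n))))) 0<ε

sumList : {A : Set} → List A → (A → ℚ) → ℚ
sumList xs f = foldr (λ x s → f x ℚ.+ s) 0ℚ xs

module _ {A : Set} where

  seq-∑ : ∀ (xs : List A) f n → seq (∑ xs f) n ≡ sumList xs (λ x → seq (f x) n)
  seq-∑ []       f n = refl
  seq-∑ (x ∷ xs) f n = cong (seq (f x) n ℚ.+_) (seq-∑ xs f n)

  sumList-cong : ∀ (xs : List A) {f g} → (∀ x → f x ≡ g x) → sumList xs f ≡ sumList xs g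
  sumList-cong []       f≗g = refl
  sumList-cong (x ∷ xs) f≗g = cong₂ ℚ._+_ (f≗g x) (sumList-cong xs f≗g)

  sumList-++ : ∀ (xs ys : List A) f → sumList (xs ++ ys) f ≡ sumList xs f ℚ.+ sumList ys f
  sumList-++ []       ys f = sym (ℚ.+-identityˡ (sumList ys f))
  sumList-++ (x ∷ xs) ys f = trans (cong (f x ℚ.+_) (sumList-++ xs ys f))
    (sym (ℚ.+-assoc (f x) (sumList xs f) (sumList ys f)))

  sumList-filter : ∀ {P : Pred A 0ℓ} (P? : Decidable P) xs f →
    sumList (filter P? xs) f ≡ sumList xs (λ x → if does (P? x) then f x else 0ℚ)
  sumList-filter P? []       f = refl
  sumList-filter P? (x ∷ xs) f with does (P? x)
  ... | true  = cong (f x ℚ.+_) (sumList-filter P? xs f)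
  ... | false = trans (sumList-filter P? xs f)
    (sym (ℚ.+-identityˡ (sumList xs (λ y → if does (P? y) then f y else 0ℚ))))

sumList-cartesianProduct : ∀ {A B : Set} (xs : List A) (ys : List B) f →
  sumList (cartesianProduct xs ys) f ≡ sumList xs (λ x → sumList ys (λ y → f (x , y)))
sumList-cartesianProduct []       ys f = refl
sumList-cartesianProduct (x ∷ xs) ys f = trans
  (sumList-++ (map (x ,_) ys) (cartesianProduct xs ys) f)
  (cong₂ ℚ._+_ (foldr-map (λ p s → f p ℚ.+ s) (x ,_) 0ℚ ys) (sumList-cartesianProduct xs ys f))

-- `F` lives on ℕ so that summation by parts may step outside the box; `t` is arbitrary because the
-- tail of `tabulate t` tabulates `t` after `fsuc`.
sumList-tabulate : ∀ {A : Set} n (t : Fin n → A) f F → (∀ i → f (t i) ≡ F (toℕ i)) →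
  sumList (tabulate t) f ≡ Σ< n F
sumList-tabulate zero    t f F ft≗F = sym (Σ<-zero F)
sumList-tabulate (suc n) t f F ft≗F = trans
  (cong₂ ℚ._+_ (ft≗F fzero)
    (sumList-tabulate n (λ i → t (fsuc i)) f (λ i → F (suc i)) (λ i → ft≗F (fsuc i))))
  (sym (Σ<-suc n F))

sumList-box : ∀ a b f F → (∀ i j → f (i , j) ≡ F (toℕ i) (toℕ j)) →
  sumList (FinPoset.elements (Box a b)) f ≡ Σ<² a b F
sumList-box a b f F f≗F = trans (sumList-cartesianProduct (allFin a) (allFin b) f)
  (sumList-tabulate a (λ i → i) (λ i → sumList (allFin b) (λ j → f (i , j))) (λ i → Σ< b (F i))
    (λ i → sumList-tabulate b (λ j → j) (λ j → f (i , j)) (F (toℕ i)) (f≗F i)))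

-- The diagonal sum and its toggleability coefficients.

theorem3p10 : (a b : ℕ) .{{_ : NonZero a}} .{{_ : NonZero b}} (k : ℤ) →
    + 1 - + a ≤ k → k ≤ + b - + 1 →
    (λ I → ∑ (diagonal a b k) (λ p → 𝟙 (Box a b) p I)) ≡ₜ const (Box a b) (fromℚ (diagonalConstant a b k))
-- All reals involved are built from embedded rationals, so the two sides agree at every index of
-- their sequences.
theorem3p10 a b k 1-a≤k k≤b-1 = coefficient , λ I → pointwise⇒≃
  (∑ (diagonal a b k) (λ p → 𝟙 (Box a b) p I) -ᴿ fromℚ c)
  (∑ box (λ x → coefficient x *ᴿ T (Box a b) x I))
  (identity I)
  where
  open Green a b k 1-a≤k k≤b-1
  open ≡-Reasoning

  box : List (Fin a × Fin b)
  box = FinPoset.elements (Box a b)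

  coefficient : Fin a × Fin b → ℝ
  -- The 0-based coordinates have the same difference as the 1-based ones.
  coefficient (p , q) = fromℚ (g (toℕ p) (toℕ q))

  c : ℚ
  c = diagonalConstant a b k

  module _ (I : OrderIdeal (Box a b)) (n : ℕ) where
    open Ideal I
    open Lattice a b g e g-shift g-top g-bot e-left e-low e-right e-high

    Σ𝟙 : ℚ
    Σ𝟙 = Σ<² a b (λ i j → (h (suc i) j ℚ.- h i j) ℚ.* e (suc i) (suc j))

    onDiagonal? : (x : Fin a × Fin b) → Dec (col {a} {b} x - row {a} {b} x ≡ k)
    onDiagonal? x = col {a} {b} x - row {a} {b} x ℤ.≟ k

    -- The mixed difference of `g` is the indicator of the diagonal, so it can serve as the filter.
    diagonal-term : ∀ p q →
      (if does (onDiagonal? (p , q)) then seq (𝟙 (Box a b) (p , q) I) n else 0ℚ) ≡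
      (h (suc (toℕ p)) (toℕ q) ℚ.- h (toℕ p) (toℕ q)) ℚ.* e (suc (toℕ p)) (suc (toℕ q))
    diagonal-term p q = begin
      (if does (onDiagonal? (p , q)) then seq (𝟙 (Box a b) (p , q) I) n else 0ℚ)
        ≡⟨ cong (λ x → if does (onDiagonal? (p , q)) then x else 0ℚ) (seq-𝟙 p q n) ⟩
      (if does (onDiagonal? (p , q)) then E else 0ℚ)
        ≡⟨ if-* (does (onDiagonal? (p , q))) ⟩
      ⟦ onDiagonal? (p , q) ⟧ ℚ.* E
        -- `col` minus `row` computes to `suc (toℕ q) ⊖ suc (toℕ p)`, which `shift` brings to the
        -- 0-based difference.
        ≡⟨ cong (ℚ._* E) (⟦⟧-cong (onDiagonal? (p , q)) (toℕ q ⊖ toℕ p - k ℤ.≟ + 0)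
             (λ eq → ℤ.i≡j⇒i-j≡0 (trans (sym shift) eq))
             (λ eq → trans shift (ℤ.i-j≡0⇒i≡j (toℕ q ⊖ toℕ p) k eq))) ⟩
      ⟦ toℕ q ⊖ toℕ p - k ℤ.≟ + 0 ⟧ ℚ.* E
        ≡⟨ cong (ℚ._* E) (g-mixedDifference (toℕ p) (toℕ q)) ⟨
      (h (suc (toℕ p)) (toℕ q) ℚ.- h (toℕ p) (toℕ q)) ℚ.* E ∎
      where
      E = e (suc (toℕ p)) (suc (toℕ q))
      shift : suc (toℕ q) ⊖ suc (toℕ p) ≡ toℕ q ⊖ toℕ p
      shift = ℤ.[1+m]⊖[1+n]≡m⊖n (toℕ q) (toℕ p)
      if-* : ∀ β → (if β then E else 0ℚ) ≡ (if β then 1ℚ else 0ℚ) ℚ.* E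
      if-* true  = sym (ℚ.*-identityˡ E)
      if-* false = sym (ℚ.*-zeroˡ E)

    diagonal-sum : seq (∑ (diagonal a b k) (λ p → 𝟙 (Box a b) p I)) n ≡ Σ𝟙
    diagonal-sum = begin
      seq (∑ (diagonal a b k) (λ p → 𝟙 (Box a b) p I)) n
        ≡⟨ seq-∑ (diagonal a b k) (λ p → 𝟙 (Box a b) p I) n ⟩
      sumList (diagonal a b k) (λ p → seq (𝟙 (Box a b) p I) n)
        ≡⟨ sumList-filter onDiagonal? box (λ p → seq (𝟙 (Box a b) p I) n) ⟩
      sumList box (λ p → if does (onDiagonal? p) then seq (𝟙 (Box a b) p I) n else 0ℚ)
        ≡⟨ sumList-box a b _ (λ i j → (h (suc i) j ℚ.- h i j) ℚ.* e (suc i) (suc j)) diagonal-term ⟩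
      Σ𝟙 ∎

    toggleability-sum :
      seq (∑ box (λ x → coefficient x *ᴿ T (Box a b) x I)) n ≡
      Σ<² a b (λ i j → g i j ℚ.* (t⁺ i j ℚ.- t⁻ (suc i) (suc j)))
    toggleability-sum = trans (seq-∑ box (λ x → coefficient x *ᴿ T (Box a b) x I) n)
      (sumList-box a b _ (λ i j → g i j ℚ.* (t⁺ i j ℚ.- t⁻ (suc i) (suc j)))
        (λ p q → cong (g (toℕ p) (toℕ q) ℚ.*_) (cong₂ ℚ._-_ (seq-T⁺ p q n) (seq-T⁻ p q n))))

    identity :
      seq (∑ (diagonal a b k) (λ p → 𝟙 (Box a b) p I) -ᴿ fromℚ c) n ≡
      seq (∑ box (λ x → coefficient x *ᴿ T (Box a b) x I)) n
    identity = begin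
      seq (∑ (diagonal a b k) (λ p → 𝟙 (Box a b) p I)) n ℚ.- c
        ≡⟨ cong (ℚ._- c) diagonal-sum ⟩
      Σ𝟙 ℚ.- c
        ≡⟨ ℚ.+-comm Σ𝟙 (ℚ.- c) ⟩
      ℚ.- c ℚ.+ Σ𝟙
        -- The constant enters here: `−c` is the boundary term left by summation by parts.
        ≡⟨ cong (ℚ._+ Σ𝟙) g-corner ⟨
      g 0 0 ℚ.+ Σ𝟙
        ≡⟨ toggle-sum ⟨
      Σ<² a b (λ i j → g i j ℚ.* (t⁺ i j ℚ.- t⁻ (suc i) (suc j)))
        ≡⟨ toggleability-sum ⟨
      seq (∑ box (λ x → coefficient x *ᴿ T (Box a b) x I)) n ∎
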